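{- For positive integers $\ell,m$, let $A(\ell,m)$ be the $(\ell+m)\times(\ell+m)$ coloring matrix with entries $a_{ij}=0$ if $i,j>\ell$ and $a_{ij}=1$ otherwise (i.e., block form with an $\ell\times\ell$ all-ones upper-left block, all-ones off-diagonal blocks, and an $m\times m$ zero lower-right block). Then for all positive integers $\ell,m,n$, $$t_{A(\ell,m)}(n)=\sum_{k=0}^{n-1}\frac{2}{n}\binom{n}{k}\binom{2n-3}{n-k-1}\ell^{n-k}m^k;$$ for $1\le i\le\ell$, $$t_{A(\ell,m)}^{(i)}(n)=\sum_{k=0}^{n-1}\frac{1}{n}\binom{n}{k}\binom{2n-2}{n-k-1}\ell^{n-k-1}m^k;$$ and for $\ell+1\le i\le\ell+m$ and $n\ge2$, $$t_{A(\ell,m)}^{(i)}(n)=\sum_{k=1}^{n-1}\frac{1}{n-1}\binom{n-1}{k-1}\binom{2n-2}{n-k-1}\ell^{n-k}m^{k-1}.$$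
   Context: A plane tree is an unlabeled rooted tree in which the children of every vertex are linearly ordered. A coloring matrix is a square matrix $A=(a_{ij})$ with entries in $\{0,1\}$. An $A$-coloring of a plane tree assigns to each vertex a color (an index of a row of $A$) such that whenever a vertex of color $j$ is a child of a vertex of color $i$, $a_{ij}=1$. Let $t_A(n)$ be the number of pairs (plane tree with $n$ vertices, $A$-coloring of it) and $t_A^{(i)}(n)$ the number of those with root color $i$. Binomial coefficients $\binom{a}{b}$ with $b<0$ or $b>a\ge0$ are $0$.
   Formalization: The first formula (for the total count) is proved for n ≥ 2 only: at n = 1 it fails as printed, since t(1) = ℓ+m while the right side is 2ℓ·C(−1,0), e.g. for ℓ=1, m=2. -}

module Defs where

open import Axiom.UniquenessOfIdentityProofs using (module Decidable⇒UIP)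
open import Data.Bool.Base using (if_then_else_)
open import Data.Fin.Base using (Fin; zero; suc; toℕ)
open import Data.Fin.Patterns using (0F; 1F)
import Data.Fin.Properties as Fin
import Data.Integer.Base as ℤ
open import Data.List.Base using (List; []; _∷_; map; foldr; upTo; length; lookup; allFin; cartesianProductWith; concatMap; deduplicate)
open import Data.List.Membership.Propositional using (_∈_; lose)
open import Data.List.Membership.Propositional.Properties using (∈-map⁺; ∈-allFin; ∈-cartesianProductWith⁺; ∈-concatMap⁺; ∈-deduplicate⁺; ∈-lookup)
open import Data.List.Relation.Unary.All as All using (All; []; _∷_)
open import Data.List.Relation.Unary.AllPairs using (_∷_)
open import Data.List.Relation.Unary.Any using (here; there; index)
open import Data.List.Relation.Unary.Any.Properties using (lookup-index)
open import Data.List.Relation.Unary.Unique.Propositional using (Unique)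
open import Data.List.Relation.Unary.Unique.DecPropositional.Properties using (deduplicate-!)
open import Data.Nat.Base using (ℕ; zero; suc; _+_; _∸_; _≤_; s≤s; NonZero; >-nonZero)
import Data.Nat.Properties as ℕ
open import Data.Product.Base using (Σ; Σ-syntax; ∃; _×_; _,_; proj₁)
open import Data.Product.Properties using (≡-dec)
open import Data.Rational.Base as ℚ using (ℚ; 0ℚ)
open import Data.Unit.Base using (⊤; tt)
open import Function.Base using (_∘_)
open import Function.Bundles using (_↔_; mk↔ₛ′)
open import Relation.Binary.Definitions using (DecidableEquality)
open import Relation.Binary.PropositionalEquality using (_≡_; refl; sym; cong; cong₂)
open import Relation.Nullary using (Dec; yes; no; does; Irrelevant; contradiction)
open import Relation.Nullary.Decidable using (_×-dec_; map′)

data PlaneTree : Set where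
  node : List PlaneTree → PlaneTree

mutual
  vertices : PlaneTree → ℕ
  vertices (node ts) = suc (forestVertices ts)

  forestVertices : List PlaneTree → ℕ
  forestVertices []       = 0
  forestVertices (t ∷ ts) = vertices t + forestVertices ts

ColoringMatrix : ℕ → Set
ColoringMatrix d = Fin d → Fin d → Fin 2

-- An arbitrary assignment of a color to every vertex of a given tree.
data Coloring (d : ℕ) : PlaneTree → Set where
  node : ∀ {ts} → Fin d → All (Coloring d) ts → Coloring d (node ts)

rootColor : ∀ {d t} → Coloring d t → Fin d
rootColor (node i _) = i

module _ {d : ℕ} (A : ColoringMatrix d) where

  mutual
    IsAColoring : ∀ {t} → Coloring d t → Set
    IsAColoring (node i cs) = CompatibleChildren i cs

    CompatibleChildren : ∀ {ts} → Fin d → All (Coloring d) ts → Set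
    CompatibleChildren i []       = ⊤
    CompatibleChildren i (c ∷ cs) =
      A i (rootColor c) ≡ 1F × IsAColoring c × CompatibleChildren i cs

  ColoredTree : ℕ → Set
  ColoredTree n =
    Σ[ t ∈ PlaneTree ] vertices t ≡ n × Σ[ c ∈ Coloring d t ] IsAColoring c

  treeRootColor : ∀ {n} → ColoredTree n → Fin d
  treeRootColor (_ , _ , c , _) = rootColor c

  RootedColoredTree : Fin d → ℕ → Set
  RootedColoredTree i n = Σ[ x ∈ ColoredTree n ] treeRootColor x ≡ i

Finite : Set → Set
Finite X = ∃ λ N → X ↔ Fin N

-- Well defined up to _≡_, as Fin M ↔ Fin N forces M ≡ N.
∣_∣ : ∀ {X} → Finite X → ℕ
∣ N , _ ∣ = N

record Listable (X : Set) : Set where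
  field
    _≟_      : DecidableEquality X
    elements : List X
    complete : ∀ x → x ∈ elements

open Listable

lookup-injective : ∀ {X : Set} {xs : List X} → Unique xs →
                   ∀ i j → lookup xs i ≡ lookup xs j → i ≡ j
lookup-injective (_   ∷ _) zero    zero    _  = refl
lookup-injective {xs = _ ∷ xs} (x∉ ∷ _) zero (suc j) eq =
  contradiction eq (All.lookup x∉ (∈-lookup {xs = xs} j))
lookup-injective {xs = _ ∷ xs} (x∉ ∷ _) (suc i) zero eq =
  contradiction (sym eq) (All.lookup x∉ (∈-lookup {xs = xs} i))
lookup-injective (_   ∷ u) (suc i) (suc j) eq =
  cong suc (lookup-injective u i j eq)

listable⇒finite : ∀ {X} → Listable X → Finite X
listable⇒finite {X} L = length xs , mk↔ₛ′ (index ∘ x∈xs) (lookup xs)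
  (λ i → lookup-injective (deduplicate-! (L ._≟_) (L .elements)) _ _
           (sym (lookup-index (x∈xs (lookup xs i)))))
  (λ x → sym (lookup-index (x∈xs x)))
  where
  xs : List X
  xs = deduplicate (L ._≟_) (L .elements)

  x∈xs : ∀ x → x ∈ xs
  x∈xs x = ∈-deduplicate⁺ (L ._≟_) (L .complete x)

decListable : ∀ {P : Set} → Dec P → Irrelevant P → Listable P
decListable P? irr ._≟_ p q = yes (irr p q)
decListable (yes p) irr .elements   = p ∷ []
decListable (no ¬p) irr .elements   = []
decListable (yes p) irr .complete q = here (irr q p)
decListable (no ¬p) irr .complete q = contradiction q ¬p

Fin-listable : ∀ {d} → Listable (Fin d)
Fin-listable ._≟_      = Fin._≟_
Fin-listable .elements = allFin _
Fin-listable .complete = ∈-allFin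

-- Only finitely many elements of the base, those in a given list, need to be
-- considered.
Σ-listable′ : ∀ {X : Set} {Y : X → Set} → DecidableEquality X → (xs : List X) →
              (∀ x → Y x → x ∈ xs) → (∀ x → Listable (Y x)) → Listable (Σ X Y)
Σ-listable′ _≟X_ xs cov LY ._≟_ = ≡-dec _≟X_ (λ {x} → LY x ._≟_)
Σ-listable′ _≟X_ xs cov LY .elements =
  concatMap (λ x → map (x ,_) (LY x .elements)) xs
Σ-listable′ _≟X_ xs cov LY .complete (x , y) =
  ∈-concatMap⁺ _ (lose (cov x y) (∈-map⁺ (x ,_) (LY x .complete y)))

Σ-listable : ∀ {X : Set} {Y : X → Set} →
             Listable X → (∀ x → Listable (Y x)) → Listable (Σ X Y)
Σ-listable LX = Σ-listable′ (LX ._≟_) (LX .elements) (λ x _ → LX .complete x)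

mutual
  _≟-tree_ : DecidableEquality PlaneTree
  node ts ≟-tree node us = map′ (cong node) (λ { refl → refl }) (ts ≟-forest us)

  _≟-forest_ : DecidableEquality (List PlaneTree)
  []       ≟-forest []       = yes refl
  []       ≟-forest (_ ∷ _)  = no λ ()
  (_ ∷ _)  ≟-forest []       = no λ ()
  (t ∷ ts) ≟-forest (u ∷ us) =
    map′ (λ { (p , q) → cong₂ _∷_ p q }) (λ { refl → refl , refl })
         ((t ≟-tree u) ×-dec (ts ≟-forest us))

-- Contains every forest with at most n vertices, among others.
forests : ℕ → List (List PlaneTree)
forests zero    = [] ∷ []
forests (suc n) =
  [] ∷ cartesianProductWith (λ us ts → node us ∷ ts) (forests n) (forests n)

forests-complete : ∀ n ts → forestVertices ts ≤ n → ts ∈ forests n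
forests-complete zero    []             _       = here refl
forests-complete zero    (node _ ∷ _)   ()
forests-complete (suc n) []             _       = here refl
forests-complete (suc n) (node us ∷ ts) (s≤s p) =
  there (∈-cartesianProductWith⁺ _
    (forests-complete n us (ℕ.m+n≤o⇒m≤o _ p))
    (forests-complete n ts (ℕ.m+n≤o⇒n≤o (forestVertices us) p)))

trees : ℕ → List PlaneTree
trees n = map node (forests n)

trees-complete : ∀ {n} t → vertices t ≡ n → t ∈ trees n
trees-complete (node ts) refl =
  ∈-map⁺ node (forests-complete _ ts (ℕ.n≤1+n _))

module _ {d : ℕ} where

  mutual
    coloring-listable : ∀ t → Listable (Coloring d t)
    coloring-listable (node ts) = record
      { _≟_      = λ { (node i cs) (node j ds) →
                       map′ (λ { (p , q) → cong₂ node p q }) (λ { refl → refl , refl })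
                            ((i Fin.≟ j) ×-dec (colorings-listable ts ._≟_ cs ds)) }
      ; elements = cartesianProductWith node (allFin d) (colorings-listable ts .elements)
      ; complete = λ { (node i cs) →
                       ∈-cartesianProductWith⁺ node (∈-allFin i)
                         (colorings-listable ts .complete cs) }
      }

    colorings-listable : ∀ ts → Listable (All (Coloring d) ts)
    colorings-listable [] = record
      { _≟_      = λ { [] [] → yes refl }
      ; elements = [] ∷ []
      ; complete = λ { [] → here refl }
      }
    colorings-listable (t ∷ ts) = record
      { _≟_      = λ { (c ∷ cs) (e ∷ es) →
                       map′ (λ { (p , q) → cong₂ _∷_ p q }) (λ { refl → refl , refl })
                            ((coloring-listable t ._≟_ c e)
                              ×-dec (colorings-listable ts ._≟_ cs es)) }
      ; elements = cartesianProductWith _∷_ (coloring-listable t .elements)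
                                            (colorings-listable ts .elements)
      ; complete = λ { (c ∷ cs) →
                       ∈-cartesianProductWith⁺ _∷_ (coloring-listable t .complete c)
                         (colorings-listable ts .complete cs) }
      }

Fin-UIP : ∀ {d} {i j : Fin d} → Irrelevant (i ≡ j)
Fin-UIP = Decidable⇒UIP.≡-irrelevant Fin._≟_

module _ {d : ℕ} (A : ColoringMatrix d) where

  mutual
    isAColoring? : ∀ {t} (c : Coloring d t) → Dec (IsAColoring A c)
    isAColoring? (node i cs) = compatibleChildren? i cs

    compatibleChildren? : ∀ {ts} i (cs : All (Coloring d) ts) →
                          Dec (CompatibleChildren A i cs)
    compatibleChildren? i []       = yes tt
    compatibleChildren? i (c ∷ cs) =
      (A i (rootColor c) Fin.≟ 1F) ×-dec (isAColoring? c) ×-dec (compatibleChildren? i cs)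

  mutual
    isAColoring-irr : ∀ {t} (c : Coloring d t) → Irrelevant (IsAColoring A c)
    isAColoring-irr (node i cs) = compatibleChildren-irr i cs

    compatibleChildren-irr : ∀ {ts} i (cs : All (Coloring d) ts) →
                             Irrelevant (CompatibleChildren A i cs)
    compatibleChildren-irr i []       _           _              = refl
    compatibleChildren-irr i (c ∷ cs) (p , q , r) (p′ , q′ , r′) =
      cong₂ _,_ (Fin-UIP p p′)
        (cong₂ _,_ (isAColoring-irr c q q′) (compatibleChildren-irr i cs r r′))

  coloredTree-listable : ∀ n → Listable (ColoredTree A n)
  coloredTree-listable n =
    Σ-listable′ _≟-tree_ (trees n) (λ t → trees-complete t ∘ proj₁) λ t →
      Σ-listable (decListable (vertices t ℕ.≟ n) ℕ.≡-irrelevant) λ _ →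
        Σ-listable (coloring-listable t) λ c →
          decListable (isAColoring? c) (isAColoring-irr c)

  coloredTree-finite : ∀ n → Finite (ColoredTree A n)
  coloredTree-finite n = listable⇒finite (coloredTree-listable n)

  rootedColoredTree-finite : ∀ i n → Finite (RootedColoredTree A i n)
  rootedColoredTree-finite i n = listable⇒finite
    (Σ-listable (coloredTree-listable n) λ x →
      decListable (treeRootColor A x Fin.≟ i) Fin-UIP)

  t : ℕ → ℕ
  t n = ∣ coloredTree-finite n ∣

  tRoot : Fin d → ℕ → ℕ
  tRoot i n = ∣ rootedColoredTree-finite i n ∣

-- Colors are numbered from 0, so i > ℓ for 1-based indices becomes ℓ ≤ toℕ i.
blockMatrix : (ℓ m : ℕ) → ColoringMatrix (ℓ + m)
blockMatrix ℓ m i j =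
  if does ((ℓ ℕ.≤? toℕ i) ×-dec (ℓ ℕ.≤? toℕ j)) then 0F else 1F

fromℕ : ℕ → ℚ
fromℕ n = ℤ.+ n ℚ./ 1

-- Both bounds are inclusive; the sum is empty if b < a.
sum[_⋯_] : ℕ → ℕ → (ℕ → ℚ) → ℚ
sum[ a ⋯ b ] f = foldr ℚ._+_ 0ℚ (map (λ j → f (a + j)) (upTo (suc b ∸ a)))

infix 5 sum-syntax
sum-syntax : ℕ → ℕ → (ℕ → ℚ) → ℚ
sum-syntax = sum[_⋯_]

syntax sum-syntax a b (λ k → e) = ∑[ k ∈ a ⋯ b ] e

n∸1-nonZero : ∀ {n} → 2 ≤ n → NonZero (n ∸ 1)
n∸1-nonZero 2≤n = >-nonZero (ℕ.m<n⇒0<n∸m 2≤n)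

{-# OPTIONS --safe #-}
module Submission where

-- Let A and B be the generating functions, by number of vertices, of the trees
-- whose root has a fixed color < ℓ, respectively ≥ ℓ, and let S = 1/(1 - ℓA).
-- Then B = zS, and cutting the children of the root at the first child of color
-- ≥ ℓ gives
--   A = zS + m z S² A,   S = 1 + ℓ A S.
-- The coefficients of A^p S^s are thus determined by two recurrences.  Lagrange
-- inversion suggests a closed form for them; written as a difference of products
-- of two binomial coefficients, it satisfies both recurrences by Pascal's rule
-- alone.  To count trees, read them depth first: a state is a stack of
-- unfinished sibling lists, and only the colors of their parents matter.

open import Defs
open import Data.Bool.Properties using (∧-zeroʳ)
open import Data.Empty using (⊥; ⊥-elim)
open import Data.Fin.Base using (Fin; zero; suc; toℕ)
open import Data.Fin.Patterns using (1F)
open import Data.Fin.Permutation using (↔⇒≡)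
open import Data.Fin.Properties using (+↔⊎)
open import Data.Integer.Base using (+_) renaming (_+_ to _+ℤ_; _*_ to _*ℤ_)
import Data.Integer.Properties as ℤ
open import Data.List.Base using (List; []; _∷_; foldr; map; upTo; applyUpTo)
open import Data.List.Properties using (map-upTo)
open import Data.List.Relation.Unary.All using (All; []; _∷_)
open import Data.Nat.Base using (ℕ; zero; suc; _+_; _*_; _∸_; _^_; _≤_; _<_; _≤ᵇ_; z≤n; s≤s; NonZero)
open import Data.Nat.Combinatorics using (_C_; k>n⇒nCk≡0; nCk+nC[k+1]≡[n+1]C[k+1])
open import Data.Nat.Properties
open import Data.Nat.Tactic.RingSolver using (solve-∀)
open import Data.Product.Base using (Σ; Σ-syntax; _×_; _,_; proj₂)
open import Data.Rational.Base using (0ℚ; toℚᵘ; _/_) renaming (_+_ to _+ℚ_; _*_ to _*ℚ_)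
import Data.Rational.Properties as ℚ
open import Data.Rational.Unnormalised.Base as ℚᵘ using (mkℚᵘ; *≡*)
import Data.Rational.Unnormalised.Properties as ℚᵘ
open import Data.Sum.Base using (_⊎_; inj₁; inj₂)
open import Data.Sum.Function.Propositional using (_⊎-↔_)
open import Data.Unit.Base using (tt)
open import Function.Base using (_∋_)
open import Function.Bundles using (_↔_; mk↔ₛ′)
open import Function.Construct.Composition using (_↔-∘_)
open import Function.Construct.Symmetry using (↔-sym)
open import Relation.Binary.PropositionalEquality
open import Relation.Nullary using (contradiction; Irrelevant)
open import Relation.Nullary.Decidable using (dec-true; dec-false)

open ≡-Reasoning

-- Binomial coefficients and the coefficients of A^p S^s

-- Shifting an index down by one, with value 0 at index 0: n C⁻ k is C(n, k - 1).
shift : (ℕ → ℕ) → ℕ → ℕ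
shift f zero    = 0
shift f (suc k) = f k

infix 8 _C⁻_
_C⁻_ : ℕ → ℕ → ℕ
n C⁻ k = shift (n C_) k

pascal : ∀ n k → suc n C k ≡ n C⁻ k + n C k
pascal n zero    = refl
pascal n (suc k) = sym (nCk+nC[k+1]≡[n+1]C[k+1] n k)

-- Induction on `n`: Pascal's rule splits the left side into two instances of the claim and
-- recombines their right sides. No division or factorial occurs, and `C⁻` makes `k` = 0 an ordinary
-- case.
absorption : ∀ n k → k * (suc n C k) ≡ suc n * (n C⁻ k)
absorption n       zero          = sym (*-zeroʳ n)
absorption zero    (suc zero)    = refl
absorption zero    (suc (suc k)) = trans (cong (suc (suc k) *_) (k>n⇒nCk≡0 {1} {2 + k} (s≤s (s≤s z≤n)))) (*-zeroʳ k)
absorption (suc n) (suc k)       = begin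
  suc k * (suc (suc n) C suc k)            ≡⟨ cong (suc k *_) (pascal (suc n) (suc k)) ⟩
  suc k * (a + suc n C suc k)              ≡⟨ *-distribˡ-+ (suc k) a _ ⟩
  suc k * a + suc k * (suc n C suc k)      ≡⟨ cong₂ (λ x y → a + x + y) (absorption n k) (absorption n (suc k)) ⟩
  a + suc n * (n C⁻ k) + suc n * (n C k)   ≡⟨ lemma a n (n C⁻ k) (n C k) ⟩
  a + suc n * (n C⁻ k + n C k)             ≡⟨ cong (λ x → a + suc n * x) (pascal n k) ⟨
  suc (suc n) * a                          ∎
  where
  a = suc n C k

  lemma : ∀ a n x y → a + suc n * x + suc n * y ≡ a + suc n * (x + y)
  lemma = solve-∀

-- Adding `absorption` to it gives Pascal's rule times `suc n`. The equation `k + i ≡ suc n` stands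
-- in for a truncated subtraction.
absorption-complement : ∀ n k i → k + i ≡ suc n → suc n * (n C k) ≡ i * (suc n C k)
absorption-complement n k i eq = +-cancelˡ-≡ (k * (suc n C k)) _ _ (begin
  k * (suc n C k) + suc n * (n C k)      ≡⟨ cong (_+ suc n * (n C k)) (absorption n k) ⟩
  suc n * (n C⁻ k) + suc n * (n C k)     ≡⟨ *-distribˡ-+ (suc n) (n C⁻ k) _ ⟨
  suc n * (n C⁻ k + n C k)               ≡⟨ cong₂ _*_ (sym eq) (sym (pascal n k)) ⟩
  (k + i) * (suc n C k)                  ≡⟨ *-distribʳ-+ (suc n C k) k i ⟩
  k * (suc n C k) + i * (suc n C k)      ∎)

-- The ratio of neighbouring entries in a row, from expanding `absorption` by Pascal's rule.
adjacent : ∀ n k i → k + i ≡ suc n → k * (n C k) ≡ i * (n C⁻ k)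
adjacent n k i eq = +-cancelˡ-≡ (k * (n C⁻ k)) _ _ (begin
  k * (n C⁻ k) + k * (n C k)     ≡⟨ *-distribˡ-+ k (n C⁻ k) _ ⟨
  k * (n C⁻ k + n C k)           ≡⟨ cong (k *_) (pascal n k) ⟨
  k * (suc n C k)                ≡⟨ absorption n k ⟩
  suc n * (n C⁻ k)               ≡⟨ cong (_* (n C⁻ k)) eq ⟨
  (k + i) * (n C⁻ k)             ≡⟨ *-distribʳ-+ (n C⁻ k) k i ⟩
  k * (n C⁻ k) + i * (n C⁻ k)    ∎)

-- The coefficient of m^k ℓ^j z^(p+k+j) in A^p S^s.
coeff : (p s k j : ℕ) → ℕ
coeff zero    zero    zero    zero    = 1
coeff zero    zero    zero    (suc j) = 0
coeff zero    zero    (suc k) j       = 0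
coeff zero    (suc s) k       zero    = coeff zero s k zero
coeff zero    (suc s) k       (suc j) = coeff zero s k (suc j) + coeff 1 (suc s) k j
coeff (suc p) s       zero    j       = coeff p (suc s) zero j
coeff (suc p) s       (suc k) j       = coeff p (suc s) (suc k) j + coeff (suc p) (suc (suc s)) k j

-- Recurrences for the coefficients

-- This is S = 1 + ℓ A S multiplied by A^p S^s. `coeff` has it by definition only for `p` = 0; for
-- larger `p`, expand one factor A and apply the claim to both summands.
coeff-sucˢ : ∀ p s k j →
  coeff p (suc s) k j ≡ coeff p s k j + shift (coeff (suc p) (suc s) k) j
coeff-sucˢ zero    s k       zero    = sym (+-identityʳ _)
coeff-sucˢ zero    s k       (suc j) = refl
coeff-sucˢ (suc p) s zero    zero    = coeff-sucˢ p (suc s) zero zero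
coeff-sucˢ (suc p) s zero    (suc j) = coeff-sucˢ p (suc s) zero (suc j)
coeff-sucˢ (suc p) s (suc k) zero    = begin
  coeff p (2 + s) (suc k) 0 + coeff (suc p) (3 + s) k 0
    ≡⟨ cong₂ _+_ (coeff-sucˢ p (1 + s) (suc k) 0) (coeff-sucˢ (suc p) (2 + s) k 0) ⟩
  (coeff p (1 + s) (suc k) 0 + 0) + (coeff (suc p) (2 + s) k 0 + 0)
    ≡⟨ lemma (coeff p (1 + s) (suc k) 0) _ ⟩
  (coeff p (1 + s) (suc k) 0 + coeff (suc p) (2 + s) k 0) + 0 ∎
  where
  lemma : ∀ a b → (a + 0) + (b + 0) ≡ (a + b) + 0
  lemma = solve-∀
coeff-sucˢ (suc p) s (suc k) (suc j) = begin
  coeff p (2 + s) (suc k) (suc j) + coeff (suc p) (3 + s) k (suc j)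
    ≡⟨ cong₂ _+_ (coeff-sucˢ p (1 + s) (suc k) (suc j)) (coeff-sucˢ (suc p) (2 + s) k (suc j)) ⟩
  (coeff p (1 + s) (suc k) (suc j) + coeff (suc p) (2 + s) (suc k) j) +
  (coeff (suc p) (2 + s) k (suc j) + coeff (2 + p) (3 + s) k j)
    ≡⟨ lemma (coeff p (1 + s) (suc k) (suc j)) _ _ _ ⟩
  (coeff p (1 + s) (suc k) (suc j) + coeff (suc p) (2 + s) k (suc j)) +
  (coeff (suc p) (2 + s) (suc k) j + coeff (2 + p) (3 + s) k j) ∎
  where
  lemma : ∀ a b c d → (a + b) + (c + d) ≡ (a + c) + (b + d)
  lemma = solve-∀

-- This is A = z + A (ℓ A + m z S) multiplied by A^p S^s: a root of color < ℓ has no child, or a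
-- first child of either kind. It results from A = zS + m z S² A by applying S = 1 + ℓ A S once in
-- each summand.
coeff-sucᵖ : ∀ p s k j →
  coeff (suc p) s k j ≡
  coeff p s k j + (shift (coeff (suc (suc p)) s k) j + shift (λ k → coeff (suc p) (suc s) k j) k)
coeff-sucᵖ p s zero    zero    = coeff-sucˢ p s zero zero
coeff-sucᵖ p s zero    (suc j) =
  trans (coeff-sucˢ p s zero (suc j)) (cong (λ x → coeff p s zero (suc j) + x) (sym (+-identityʳ _)))
coeff-sucᵖ p s (suc k) zero    = begin
  coeff p (1 + s) (suc k) 0 + coeff (suc p) (2 + s) k 0
    ≡⟨ cong₂ _+_ (coeff-sucˢ p s (suc k) 0) (coeff-sucˢ (suc p) (1 + s) k 0) ⟩
  (coeff p s (suc k) 0 + 0) + (coeff (suc p) (1 + s) k 0 + 0)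
    ≡⟨ lemma (coeff p s (suc k) 0) _ ⟩
  coeff p s (suc k) 0 + (0 + coeff (suc p) (1 + s) k 0) ∎
  where
  lemma : ∀ a b → (a + 0) + (b + 0) ≡ a + (0 + b)
  lemma = solve-∀
coeff-sucᵖ p s (suc k) (suc j) = begin
  coeff p (1 + s) (suc k) (suc j) + coeff (suc p) (2 + s) k (suc j)
    ≡⟨ cong₂ _+_ (coeff-sucˢ p s (suc k) (suc j)) (coeff-sucˢ (suc p) (1 + s) k (suc j)) ⟩
  (coeff p s (suc k) (suc j) + coeff (suc p) (1 + s) (suc k) j) +
  (coeff (suc p) (1 + s) k (suc j) + coeff (2 + p) (2 + s) k j)
    ≡⟨ lemma (coeff p s (suc k) (suc j)) _ _ _ ⟩
  coeff p s (suc k) (suc j) +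
  ((coeff (suc p) (1 + s) (suc k) j + coeff (2 + p) (2 + s) k j) + coeff (suc p) (1 + s) k (suc j)) ∎
  where
  lemma : ∀ a b c d → (a + b) + (c + d) ≡ a + ((b + d) + c)
  lemma = solve-∀

coeff-0-0 : ∀ p s → coeff p s 0 0 ≡ 1
coeff-0-0 zero    zero    = refl
coeff-0-0 zero    (suc s) = coeff-0-0 zero s
coeff-0-0 (suc p) s       = coeff-0-0 p (suc s)

-- Closed form of the coefficients

-- The case p = s = 0, where the coefficient vanishes.
coeff-difference-base : ∀ k j ν N → suc ν ≡ k + j → suc N ≡ 2 * (k + j) →
  (ν C k + 2 * (ν C⁻ k)) * (N C⁻ j) ≡ (ν C k) * (N C j)
coeff-difference-base k j ν N eν eN = *-cancelˡ-≡ _ _ (suc ν) (begin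
  -- The factor `suc ν` turns both binomials of `ν` into multiples of `suc ν C k`; then
  -- `j + (2 * k + j)` equals `suc N`, so `adjacent` applies.
  suc ν * ((ν C k + 2 * (ν C⁻ k)) * y)             ≡⟨ l₁ ν (ν C k) (ν C⁻ k) y ⟩
  (suc ν * (ν C k) + 2 * (suc ν * (ν C⁻ k))) * y   ≡⟨ cong₂ (λ u v → (u + 2 * v) * y)
                                                        (absorption-complement ν k j (sym eν)) (sym (absorption ν k)) ⟩
  (j * d + 2 * (k * d)) * y                        ≡⟨ l₂ j k d y ⟩
  d * ((2 * k + j) * y)                            ≡⟨ cong (d *_) (adjacent N j (2 * k + j) (trans (l₃ k j) (sym eN))) ⟨
  d * (j * x)                                      ≡⟨ l₄ d j x ⟩
  (j * d) * x                                      ≡⟨ cong (_* x) (absorption-complement ν k j (sym eν)) ⟨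
  suc ν * (ν C k) * x                              ≡⟨ *-assoc (suc ν) (ν C k) x ⟩
  suc ν * ((ν C k) * x)                            ∎)
  where
  d = suc ν C k
  x = N C j
  y = N C⁻ j

  l₁ : ∀ ν a b y → suc ν * ((a + 2 * b) * y) ≡ (suc ν * a + 2 * (suc ν * b)) * y
  l₁ = solve-∀
  l₂ : ∀ j k d y → (j * d + 2 * (k * d)) * y ≡ d * ((2 * k + j) * y)
  l₂ = solve-∀
  l₃ : ∀ k j → j + (2 * k + j) ≡ 2 * (k + j)
  l₃ = solve-∀
  l₄ : ∀ d j x → d * (j * x) ≡ (j * d) * x
  l₄ = solve-∀

-- Here ν = n - 1 for n = p + k + j, and N = 2n - p + s - 1.
coeff-difference : ∀ p s k j ν N → suc ν ≡ p + (k + j) → suc N ≡ p + (s + 2 * (k + j)) →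
  coeff p s k j + (ν C k + 2 * (ν C⁻ k)) * (N C⁻ j) ≡ (ν C k) * (N C j)
coeff-difference zero zero zero zero ν N () eN
coeff-difference zero zero zero (suc j) ν N eν eN = coeff-difference-base 0 (suc j) ν N eν eN
coeff-difference zero zero (suc k) j ν N eν eN = coeff-difference-base (suc k) j ν N eν eN
-- `N` = 0 would force `k + j` = 0, but `eν` makes it positive.
coeff-difference zero (suc s) k j ν zero eν eN =
  contradiction (trans eν (m+n≡0⇒m≡0 (k + j) (m+n≡0⇒n≡0 s (sym (suc-injective eN))))) 1+n≢0
coeff-difference zero (suc s) k zero ν (suc N) eν eN =
  coeff-difference zero s k zero ν N eν (suc-injective eN)
-- Pascal's rule for row `suc N` splits both products just as S^(s+1) = S^s + ℓ A S^(s+1) splits the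
-- coefficient.
coeff-difference zero (suc s) k (suc j) ν (suc N) eν eN = begin
  (coeff 0 s k (suc j) + coeff 1 (suc s) k j) + K * (suc N C j)
    ≡⟨ cong (λ y → (coeff 0 s k (suc j) + coeff 1 (suc s) k j) + K * y) (pascal N j) ⟩
  (coeff 0 s k (suc j) + coeff 1 (suc s) k j) + K * (N C⁻ j + N C j)
    ≡⟨ l₁ (coeff 0 s k (suc j)) _ K (N C⁻ j) (N C j) ⟩
  (coeff 1 (suc s) k j + K * (N C⁻ j)) + (coeff 0 s k (suc j) + K * (N C j))
    ≡⟨ cong₂ _+_
         (coeff-difference 1 (suc s) k j ν N (trans eν (+-suc k j))
           (trans (suc-injective eN) (l₂ s k j)))
         (coeff-difference 0 s k (suc j) ν N eν (suc-injective eN)) ⟩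
  (ν C k) * (N C j) + (ν C k) * (N C suc j)
    ≡⟨ *-distribˡ-+ (ν C k) (N C j) _ ⟨
  (ν C k) * (N C j + N C suc j)
    ≡⟨ cong ((ν C k) *_) (pascal N (suc j)) ⟨
  (ν C k) * (suc N C suc j) ∎
  where
  K = ν C k + 2 * (ν C⁻ k)

  l₁ : ∀ a b K y x → (a + b) + K * (y + x) ≡ (b + K * y) + (a + K * x)
  l₁ = solve-∀
  l₂ : ∀ s k j → s + 2 * (k + suc j) ≡ 1 + (suc s + 2 * (k + j))
  l₂ = solve-∀
-- The only case of positive `p` in which `ν` cannot be lowered; both sides are 1.
coeff-difference (suc zero)    s zero    zero    zero    N eν eN = cong (_+ 0) (coeff-0-0 0 s)
coeff-difference (suc zero)    s zero    (suc j) zero    N () eN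
coeff-difference (suc zero)    s (suc k) j       zero    N () eN
coeff-difference (suc (suc p)) s k       j       zero    N () eN
coeff-difference (suc p)       s zero    j       (suc ν) N eν eN =
  coeff-difference p (suc s) zero j ν N (suc-injective eν) (trans eN (sym (+-suc p _)))
-- Now Pascal's rule for row `suc ν` matches the expansion of one factor A, while `N` stays fixed.
coeff-difference (suc p)       s (suc k) j       (suc ν) N eν eN = begin
  (coeff p (suc s) (suc k) j + coeff (suc p) (2 + s) k j) + (suc ν C suc k + 2 * (suc ν C k)) * y
    ≡⟨ cong₂ (λ u v → (coeff p (suc s) (suc k) j + coeff (suc p) (2 + s) k j) + (u + 2 * v) * y)
         (pascal ν (suc k)) (pascal ν k) ⟩
  (coeff p (suc s) (suc k) j + coeff (suc p) (2 + s) k j) + ((ν C k + ν C suc k) + 2 * (ν C⁻ k + ν C k)) * y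
    ≡⟨ l₁ (coeff p (suc s) (suc k) j) _ (ν C k) (ν C suc k) (ν C⁻ k) y ⟩
  (coeff (suc p) (2 + s) k j + (ν C k + 2 * (ν C⁻ k)) * y) +
  (coeff p (suc s) (suc k) j + (ν C suc k + 2 * (ν C k)) * y)
    ≡⟨ cong₂ _+_
         (coeff-difference (suc p) (2 + s) k j ν N (trans (suc-injective eν) (+-suc p (k + j)))
           (trans eN (l₂ p s k j)))
         (coeff-difference p (suc s) (suc k) j ν N (suc-injective eν) (trans eN (sym (+-suc p _)))) ⟩
  (ν C k) * x + (ν C suc k) * x
    ≡⟨ *-distribʳ-+ x (ν C k) _ ⟨
  (ν C k + ν C suc k) * x
    ≡⟨ cong (_* x) (pascal ν (suc k)) ⟨
  (suc ν C suc k) * x ∎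
  where
  x = N C j
  y = N C⁻ j

  l₁ : ∀ a b c d e y → (a + b) + ((c + d) + 2 * (e + c)) * y ≡ (b + (c + 2 * e) * y) + (a + (d + 2 * c) * y)
  l₁ = solve-∀
  l₂ : ∀ p s k j → suc p + (s + 2 * (suc k + j)) ≡ suc p + (2 + s + 2 * (k + j))
  l₂ = solve-∀

-- The form suggested by Lagrange inversion. Multiply `coeff-difference` by `suc ν`, absorb that
-- factor into `suc ν C k`, and use `adjacent` in row `N`. Adding the same multiple of `N C⁻ j` to
-- both sides avoids subtraction.
coeff-closed : ∀ p s k j ν N → suc ν ≡ p + (k + j) → suc N ≡ p + (s + 2 * (k + j)) →
  suc ν * coeff p s k j ≡ (suc ν C k) * (p * (N C j) + s * (N C⁻ j))
coeff-closed p s k j ν N eν eN = +-cancelʳ-≡ ((p + j + 2 * k) * d * y) _ _ (begin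
  suc ν * c + (p + j + 2 * k) * d * y
    ≡⟨ l₁ (suc ν * c) (p + j) k d y ⟩
  suc ν * c + ((p + j) * d + 2 * (k * d)) * y
    ≡⟨ cong₂ (λ u v → suc ν * c + (u + 2 * v) * y) (sym complement) (absorption ν k) ⟩
  suc ν * c + (suc ν * (ν C k) + 2 * (suc ν * (ν C⁻ k))) * y
    ≡⟨ l₂ ν c (ν C k) (ν C⁻ k) y ⟩
  suc ν * (c + (ν C k + 2 * (ν C⁻ k)) * y)
    ≡⟨ cong (suc ν *_) (coeff-difference p s k j ν N eν eN) ⟩
  suc ν * ((ν C k) * x)
    ≡⟨ *-assoc (suc ν) (ν C k) x ⟨
  suc ν * (ν C k) * x
    ≡⟨ cong (_* x) complement ⟩
  (p + j) * d * x
    ≡⟨ l₃ p j d x ⟩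
  d * (p * x) + d * (j * x)
    ≡⟨ cong (λ z → d * (p * x) + d * z) (adjacent N j (p + s + 2 * k + j) (trans (l₄ p s k j) (sym eN))) ⟩
  d * (p * x) + d * ((p + s + 2 * k + j) * y)
    ≡⟨ l₅ p s k j d x y ⟩
  d * (p * x + s * y) + (p + j + 2 * k) * d * y ∎)
  where
  c = coeff p s k j
  d = suc ν C k
  x = N C j
  y = N C⁻ j

  l₀ : ∀ p k j → k + (p + j) ≡ p + (k + j)
  l₀ = solve-∀
  l₁ : ∀ u i k d y → u + (i + 2 * k) * d * y ≡ u + (i * d + 2 * (k * d)) * y
  l₁ = solve-∀
  l₂ : ∀ ν c a b y → suc ν * c + (suc ν * a + 2 * (suc ν * b)) * y ≡ suc ν * (c + (a + 2 * b) * y)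
  l₂ = solve-∀
  l₃ : ∀ p j d x → (p + j) * d * x ≡ d * (p * x) + d * (j * x)
  l₃ = solve-∀
  l₄ : ∀ p s k j → j + (p + s + 2 * k + j) ≡ p + (s + 2 * (k + j))
  l₄ = solve-∀
  l₅ : ∀ p s k j d x y →
    d * (p * x) + d * ((p + s + 2 * k + j) * y) ≡ d * (p * x + s * y) + (p + j + 2 * k) * d * y
  l₅ = solve-∀

  complement : suc ν * (ν C k) ≡ (p + j) * d
  complement = absorption-complement ν k (p + j) (trans (l₀ p k j) (sym eν))

-- Sums over k + j = n

antidiag : ℕ → (ℕ → ℕ → ℕ) → ℕ
antidiag zero    f = f 0 0
antidiag (suc n) f = f 0 (suc n) + antidiag n (λ k → f (suc k))

antidiag-cong : ∀ n {f g} → (∀ k j → k + j ≡ n → f k j ≡ g k j) → antidiag n f ≡ antidiag n g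
antidiag-cong zero    f≡g = f≡g 0 0 refl
antidiag-cong (suc n) f≡g =
  cong₂ _+_ (f≡g 0 (suc n) refl) (antidiag-cong n λ k j eq → f≡g (suc k) j (cong suc eq))

antidiag-+ : ∀ n f g → antidiag n (λ k j → f k j + g k j) ≡ antidiag n f + antidiag n g
antidiag-+ zero    f g = refl
antidiag-+ (suc n) f g =
  trans (cong (λ x → f 0 (suc n) + g 0 (suc n) + x) (antidiag-+ n _ _)) (lemma (f 0 (suc n)) _ _ _)
  where
  lemma : ∀ a b c d → (a + b) + (c + d) ≡ (a + c) + (b + d)
  lemma = solve-∀

antidiag-* : ∀ c n f → antidiag n (λ k j → c * f k j) ≡ c * antidiag n f
antidiag-* c zero    f = refl
antidiag-* c (suc n) f =
  trans (cong (λ x → c * f 0 (suc n) + x) (antidiag-* c n _)) (sym (*-distribˡ-+ c (f 0 (suc n)) _))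

antidiag-shiftʳ : ∀ n f → antidiag (suc n) (λ k → shift (f k)) ≡ antidiag n f
antidiag-shiftʳ zero    f = +-identityʳ (f 0 0)
antidiag-shiftʳ (suc n) f = cong (λ x → f 0 (suc n) + x) (antidiag-shiftʳ n (λ k → f (suc k)))

-- Evaluation at ℓ and m

module _ (ℓ m : ℕ) where

  weighted : ℕ → (ℕ → ℕ → ℕ) → ℕ
  weighted n f = antidiag n (λ k j → f k j * (ℓ ^ j * m ^ k))

  weighted-cong : ∀ n {f g} → (∀ k j → f k j ≡ g k j) → weighted n f ≡ weighted n g
  weighted-cong n f≡g = antidiag-cong n λ k j _ → cong (_* (ℓ ^ j * m ^ k)) (f≡g k j)

  weighted-+ : ∀ n f g → weighted n (λ k j → f k j + g k j) ≡ weighted n f + weighted n g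
  weighted-+ n f g = trans
    (antidiag-cong n λ k j _ → *-distribʳ-+ (ℓ ^ j * m ^ k) (f k j) (g k j))
    (antidiag-+ n (λ k j → f k j * (ℓ ^ j * m ^ k)) _)

  -- The term with `j` = 0 vanishes, and every other term has a factor ℓ to spare.
  weighted-shiftʳ : ∀ n f → weighted (suc n) (λ k → shift (f k)) ≡ ℓ * weighted n f
  weighted-shiftʳ n f = begin
    weighted (suc n) (λ k → shift (f k))
      ≡⟨ antidiag-cong (suc n) term ⟩
    antidiag (suc n) (λ k → shift (λ j → ℓ * (f k j * (ℓ ^ j * m ^ k))))
      ≡⟨ antidiag-shiftʳ n _ ⟩
    antidiag n (λ k j → ℓ * (f k j * (ℓ ^ j * m ^ k)))
      ≡⟨ antidiag-* ℓ n _ ⟩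
    ℓ * weighted n f ∎
    where
    lemma : ∀ a ℓ x y → a * ((ℓ * x) * y) ≡ ℓ * (a * (x * y))
    lemma = solve-∀

    term : ∀ k j → k + j ≡ suc n →
      shift (f k) j * (ℓ ^ j * m ^ k) ≡ shift (λ j → ℓ * (f k j * (ℓ ^ j * m ^ k))) j
    term k zero    _ = refl
    term k (suc j) _ = lemma (f k j) ℓ (ℓ ^ j) (m ^ k)

  weighted-shiftˡ : ∀ n f → weighted (suc n) (λ k j → shift (λ k → f k j) k) ≡ m * weighted n f
  weighted-shiftˡ n f = begin
    antidiag n (λ k j → f k j * (ℓ ^ j * m ^ suc k))
      ≡⟨ antidiag-cong n (λ k j _ → lemma (f k j) m (ℓ ^ j) (m ^ k)) ⟩
    antidiag n (λ k j → m * (f k j * (ℓ ^ j * m ^ k)))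
      ≡⟨ antidiag-* m n _ ⟩
    m * weighted n f ∎
    where
    lemma : ∀ a m x y → a * (x * (m * y)) ≡ m * (a * (x * y))
    lemma = solve-∀

  -- The coefficient of z^(p+n) in A^p S^s.
  stackCount : (p s n : ℕ) → ℕ
  stackCount p s n = weighted n (coeff p s)

  stackCount-0 : ∀ p s → stackCount p s 0 ≡ 1
  stackCount-0 p s = trans (*-identityʳ _) (coeff-0-0 p s)

  stackCount-empty : ∀ n → stackCount 0 0 (suc n) ≡ 0
  stackCount-empty n = antidiag-* 0 n (λ _ _ → 0)

  stackCount-sucˢ : ∀ p s n →
    stackCount p (suc s) (suc n) ≡ stackCount p s (suc n) + ℓ * stackCount (suc p) (suc s) n
  stackCount-sucˢ p s n = begin
    stackCount p (suc s) (suc n)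
      ≡⟨ weighted-cong (suc n) (coeff-sucˢ p s) ⟩
    weighted (suc n) (λ k j → coeff p s k j + shift (coeff (suc p) (suc s) k) j)
      ≡⟨ weighted-+ (suc n) (coeff p s) (λ k → shift (coeff (suc p) (suc s) k)) ⟩
    stackCount p s (suc n) + weighted (suc n) (λ k → shift (coeff (suc p) (suc s) k))
      ≡⟨ cong (λ x → stackCount p s (suc n) + x) (weighted-shiftʳ n (coeff (suc p) (suc s))) ⟩
    stackCount p s (suc n) + ℓ * stackCount (suc p) (suc s) n ∎

  -- The summands correspond to the ways to read on below a parent of color < ℓ: the sibling list
  -- ends, or the next child has one of ℓ low or one of m high colors.
  stackCount-sucᵖ : ∀ p s n →
    stackCount (suc p) s (suc n) ≡
    stackCount p s (suc n) + (ℓ * stackCount (suc (suc p)) s n + m * stackCount (suc p) (suc s) n)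
  stackCount-sucᵖ p s n = begin
    stackCount (suc p) s (suc n)
      ≡⟨ weighted-cong (suc n) (coeff-sucᵖ p s) ⟩
    weighted (suc n) (λ k j → coeff p s k j + (f k j + g k j))
      ≡⟨ weighted-+ (suc n) (coeff p s) (λ k j → f k j + g k j) ⟩
    stackCount p s (suc n) + weighted (suc n) (λ k j → f k j + g k j)
      ≡⟨ cong (λ x → stackCount p s (suc n) + x) (weighted-+ (suc n) f g) ⟩
    stackCount p s (suc n) + (weighted (suc n) f + weighted (suc n) g)
      ≡⟨ cong₂ (λ x y → stackCount p s (suc n) + (x + y))
           (weighted-shiftʳ n (coeff (suc (suc p)) s)) (weighted-shiftˡ n (coeff (suc p) (suc s))) ⟩
    stackCount p s (suc n) + (ℓ * stackCount (suc (suc p)) s n + m * stackCount (suc p) (suc s) n) ∎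
    where
    f g : ℕ → ℕ → ℕ
    f k j = shift (coeff (suc (suc p)) s k) j
    g k j = shift (λ k → coeff (suc p) (suc s) k j) k

-- Counting colored trees

resize : ∀ {X : Set} {a b} → a ≡ b → X ↔ Fin a → X ↔ Fin b
resize refl f = f

card-unique : ∀ {X} (F : Finite X) {N} → X ↔ Fin N → ∣ F ∣ ≡ N
card-unique (_ , X↔M) X↔N = ↔⇒≡ (X↔N ↔-∘ ↔-sym X↔M)

¬↔Fin0 : ∀ {X : Set} → (X → ⊥) → X ↔ Fin 0
¬↔Fin0 ¬x = mk↔ₛ′ (λ x → ⊥-elim (¬x x)) (λ ()) (λ ()) (λ x → ⊥-elim (¬x x))

⊎↔Fin+ : ∀ {X Y : Set} {a b} → X ↔ Fin a → Y ↔ Fin b → (X ⊎ Y) ↔ Fin (a + b)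
⊎↔Fin+ f g = ↔-sym +↔⊎ ↔-∘ (f ⊎-↔ g)

ΣFin-suc : ∀ {d} (P : Fin (suc d) → Set) → Σ (Fin (suc d)) P ↔ (P zero ⊎ Σ[ i ∈ Fin d ] P (suc i))
ΣFin-suc P = mk↔ₛ′
  (λ { (zero , x) → inj₁ x ; (suc i , x) → inj₂ (i , x) })
  (λ { (inj₁ x) → zero , x ; (inj₂ (i , x)) → suc i , x })
  (λ { (inj₁ x) → refl ; (inj₂ (i , x)) → refl })
  (λ { (zero , x) → refl ; (suc i , x) → refl })

ΣFin-blocks : ∀ ℓ m {a b} (P : Fin (ℓ + m) → Set) →
  (∀ i → toℕ i < ℓ → P i ↔ Fin a) → (∀ i → ℓ ≤ toℕ i → P i ↔ Fin b) →
  Σ (Fin (ℓ + m)) P ↔ Fin (ℓ * a + m * b)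
ΣFin-blocks zero zero P low high = ¬↔Fin0 λ ()
ΣFin-blocks zero (suc m) {a} P low high =
  ⊎↔Fin+ (high zero z≤n) (ΣFin-blocks zero m {a} (λ i → P (suc i)) (λ _ ()) (λ i _ → high (suc i) z≤n))
  ↔-∘ ΣFin-suc P
ΣFin-blocks (suc ℓ) m {a} {b} P low high =
  resize (sym (+-assoc a (ℓ * a) (m * b)))
  (⊎↔Fin+ (low zero (s≤s z≤n))
    (ΣFin-blocks ℓ m (λ i → P (suc i)) (λ i i<ℓ → low (suc i) (s≤s i<ℓ)) (λ i ℓ≤i → high (suc i) (s≤s ℓ≤i)))
  ↔-∘ ΣFin-suc P)

-- Colored trees as stacks of sibling lists

module _ {d : ℕ} (A : ColoringMatrix d) where

  ForestBelow : Fin d → Set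
  ForestBelow i = Σ[ ts ∈ List PlaneTree ] Σ[ cs ∈ All (Coloring d) ts ] CompatibleChildren A i cs

  size : ∀ {st} → All ForestBelow st → ℕ
  size []             = 0
  size ((ts , _) ∷ s) = forestVertices ts + size s

  -- `st` holds the colors of the parents, innermost first; `n` counts the vertices still to be
  -- read.
  Stack : ℕ → List (Fin d) → Set
  Stack n st = Σ[ s ∈ All ForestBelow st ] size s ≡ n

  Stack-≡ : ∀ {n st} {s : All ForestBelow st} {p q : size s ≡ n} → (Stack n st ∋ s , p) ≡ (s , q)
  Stack-≡ {s = s} {p} {q} = cong (s ,_) (≡-irrelevant p q)

  rooted↔stack : ∀ i n → RootedColoredTree A i (suc n) ↔ Stack n (i ∷ [])
  rooted↔stack i n = mk↔ₛ′ to from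
    (λ { ((ts , cs , q) ∷ [] , eq) → Stack-≡ })
    (λ { ((node ts , eq , node i cs , q) , refl) →
         cong (λ e → (node ts , e , node i cs , q) , refl) (≡-irrelevant _ _) })
    where
    to : RootedColoredTree A i (suc n) → Stack n (i ∷ [])
    to ((node ts , eq , node i cs , q) , refl) = (ts , cs , q) ∷ [] , trans (+-identityʳ _) (suc-injective eq)
    from : Stack n (i ∷ []) → RootedColoredTree A i (suc n)
    from ((ts , cs , q) ∷ [] , eq) = (node ts , cong suc (trans (sym (+-identityʳ _)) eq) , node i cs , q) , refl

  colored↔rooted : ∀ n → ColoredTree A n ↔ (Σ[ i ∈ Fin d ] RootedColoredTree A i n)
  colored↔rooted n = mk↔ₛ′ (λ x → treeRootColor A x , x , refl) (λ { (i , x , _) → x })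
    (λ { (i , x , refl) → refl }) (λ _ → refl)

  stack-0-∷ : ∀ i st → Stack 0 (i ∷ st) ↔ Stack 0 st
  stack-0-∷ i st = mk↔ₛ′
    (λ { (([] , [] , tt) ∷ s , eq) → s , eq ; ((node _ ∷ _ , _) ∷ s , ()) })
    (λ { (s , eq) → ([] , [] , tt) ∷ s , eq })
    (λ { (s , eq) → refl })
    (λ { (([] , [] , tt) ∷ s , eq) → refl ; ((node _ ∷ _ , _) ∷ s , ()) })

  -- One step of the depth-first reading. An empty top list is dropped; otherwise its first vertex
  -- is read, the children of that vertex form the new top list, and its remaining siblings wait
  -- below.
  stack-suc-∷ : ∀ i n st → Stack (suc n) (i ∷ st) ↔
    (Stack (suc n) st ⊎ (Σ[ j ∈ Fin d ] A i j ≡ 1F × Stack n (j ∷ i ∷ st)))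
  stack-suc-∷ i n st = mk↔ₛ′ to from
    (λ { (inj₁ (s , eq)) → refl
       ; (inj₂ (j , p , (us , ds , q) ∷ (ts , cs , r) ∷ s , eq)) → cong (λ x → inj₂ (j , p , x)) Stack-≡ })
    (λ { (([] , [] , tt) ∷ s , eq) → refl
       ; ((node us ∷ ts , node j ds ∷ cs , p , q , r) ∷ s , eq) → Stack-≡ })
    where
    to : Stack (suc n) (i ∷ st) → Stack (suc n) st ⊎ (Σ[ j ∈ Fin d ] A i j ≡ 1F × Stack n (j ∷ i ∷ st))
    to (([] , [] , tt) ∷ s , eq) = inj₁ (s , eq)
    to ((node us ∷ ts , node j ds ∷ cs , p , q , r) ∷ s , eq) =
      inj₂ (j , p , (us , ds , q) ∷ (ts , cs , r) ∷ s ,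
            trans (sym (+-assoc (forestVertices us) _ _)) (suc-injective eq))
    from : Stack (suc n) st ⊎ (Σ[ j ∈ Fin d ] A i j ≡ 1F × Stack n (j ∷ i ∷ st)) → Stack (suc n) (i ∷ st)
    from (inj₁ (s , eq)) = ([] , [] , tt) ∷ s , eq
    from (inj₂ (j , p , (us , ds , q) ∷ (ts , cs , r) ∷ s , eq)) =
      (node us ∷ ts , node j ds ∷ cs , p , q , r) ∷ s ,
      cong suc (trans (+-assoc (forestVertices us) _ _) eq)

-- Counting stacks for the block matrix

blockMatrix-lowˡ : ∀ ℓ m i j → toℕ i < ℓ → blockMatrix ℓ m i j ≡ 1F
blockMatrix-lowˡ ℓ m i j i<ℓ rewrite dec-false (ℓ ≤? toℕ i) (<⇒≱ i<ℓ) = refl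

blockMatrix-lowʳ : ∀ ℓ m i j → toℕ j < ℓ → blockMatrix ℓ m i j ≡ 1F
blockMatrix-lowʳ ℓ m i j j<ℓ
  rewrite dec-false (ℓ ≤? toℕ j) (<⇒≱ j<ℓ) | ∧-zeroʳ (ℓ ≤ᵇ toℕ i) = refl

blockMatrix-high : ∀ ℓ m i j → ℓ ≤ toℕ i → ℓ ≤ toℕ j → blockMatrix ℓ m i j ≢ 1F
blockMatrix-high ℓ m i j ℓ≤i ℓ≤j
  rewrite dec-true (ℓ ≤? toℕ i) ℓ≤i | dec-true (ℓ ≤? toℕ j) ℓ≤j = λ ()

-- Applied to the edge condition `A i j ≡ 1F`: where it holds, it contributes a factor 1.
inhabited×↔ : ∀ {P X Y : Set} → Irrelevant P → P → X ↔ Y → (P × X) ↔ Y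
inhabited×↔ irr p X↔Y = X↔Y ↔-∘ mk↔ₛ′ proj₂ (p ,_) (λ _ → refl) (λ { (q , x) → cong (_, x) (irr p q) })

module _ (ℓ m : ℕ) where

  private A = blockMatrix ℓ m

  -- A sibling list has generating function A/z below a low color and B/z = S below a high one, so
  -- stacks over `st` are counted by A^p S^s / z^p.
  data Shape : List (Fin (ℓ + m)) → ℕ → ℕ → Set where
    []   : Shape [] 0 0
    low  : ∀ {i st p s} → toℕ i < ℓ → Shape st p s → Shape (i ∷ st) (suc p) s
    high : ∀ {i st p s} → ℓ ≤ toℕ i → Shape st p s → Shape (i ∷ st) p (suc s)

  -- Induction on `n`, then on the stack: dropping a list reads no vertex but shortens the stack.
  -- Each reading step matches a recurrence of `stackCount`.
  stack↔Fin : ∀ n {st p s} → Shape st p s → Stack A n st ↔ Fin (stackCount ℓ m p s n)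
  stack↔Fin zero [] = mk↔ₛ′ (λ _ → zero) (λ _ → [] , refl) (λ { zero → refl }) (λ { ([] , refl) → refl })
  stack↔Fin zero {p = suc p} {s} (low {i} {st} _ sh) =
    resize (trans (stackCount-0 ℓ m p s) (sym (stackCount-0 ℓ m (suc p) s)))
      (stack↔Fin zero sh ↔-∘ stack-0-∷ A i st)
  stack↔Fin zero {p = p} {suc s} (high {i} {st} _ sh) =
    resize (trans (stackCount-0 ℓ m p s) (sym (stackCount-0 ℓ m p (suc s))))
      (stack↔Fin zero sh ↔-∘ stack-0-∷ A i st)
  stack↔Fin (suc n) [] =
    resize (sym (stackCount-empty ℓ m n)) (¬↔Fin0 λ { ([] , ()) })
  stack↔Fin (suc n) {p = suc p} {s} (low {i} {st} i<ℓ sh) =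
    resize (sym (stackCount-sucᵖ ℓ m p s n))
      (⊎↔Fin+ (stack↔Fin (suc n) sh)
        (ΣFin-blocks ℓ m _
          (λ j j<ℓ → inhabited×↔ Fin-UIP (blockMatrix-lowˡ ℓ m i j i<ℓ)
                       (stack↔Fin n (low j<ℓ (low i<ℓ sh))))
          (λ j ℓ≤j → inhabited×↔ Fin-UIP (blockMatrix-lowˡ ℓ m i j i<ℓ)
                       (stack↔Fin n (high ℓ≤j (low i<ℓ sh)))))
      ↔-∘ stack-suc-∷ A i n st)
  stack↔Fin (suc n) {p = p} {suc s} (high {i} {st} ℓ≤i sh) =
    -- No high color may follow a high parent, so the fibres over the high colors are empty and
    -- `m * 0` has to be removed.
    resize
      (trans (cong (λ x → stackCount ℓ m p s (suc n) + x)
                (trans (cong (λ x → ℓ * stackCount ℓ m (suc p) (suc s) n + x) (*-zeroʳ m)) (+-identityʳ _)))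
        (sym (stackCount-sucˢ ℓ m p s n)))
      (⊎↔Fin+ (stack↔Fin (suc n) sh)
        (ΣFin-blocks ℓ m _
          (λ j j<ℓ → inhabited×↔ Fin-UIP (blockMatrix-lowʳ ℓ m i j j<ℓ)
                       (stack↔Fin n (low j<ℓ (high ℓ≤i sh))))
          (λ j ℓ≤j → ¬↔Fin0 λ { (p , _) → blockMatrix-high ℓ m i j ℓ≤i ℓ≤j p }))
      ↔-∘ stack-suc-∷ A i n st)

  rooted-low↔Fin : ∀ n i → toℕ i < ℓ → RootedColoredTree A i (suc n) ↔ Fin (stackCount ℓ m 1 0 n)
  rooted-low↔Fin n i i<ℓ = stack↔Fin n (low i<ℓ []) ↔-∘ rooted↔stack A i n

  rooted-high↔Fin : ∀ n i → ℓ ≤ toℕ i → RootedColoredTree A i (suc n) ↔ Fin (stackCount ℓ m 0 1 n)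
  rooted-high↔Fin n i ℓ≤i = stack↔Fin n (high ℓ≤i []) ↔-∘ rooted↔stack A i n

  tRoot-low : ∀ n i → toℕ i < ℓ → tRoot A i (suc n) ≡ stackCount ℓ m 1 0 n
  tRoot-low n i i<ℓ = card-unique (rootedColoredTree-finite A i (suc n)) (rooted-low↔Fin n i i<ℓ)

  tRoot-high : ∀ n i → ℓ ≤ toℕ i → tRoot A i (suc n) ≡ stackCount ℓ m 0 1 n
  tRoot-high n i ℓ≤i = card-unique (rootedColoredTree-finite A i (suc n)) (rooted-high↔Fin n i ℓ≤i)

  t-total : ∀ n → t A (suc n) ≡ ℓ * stackCount ℓ m 1 0 n + m * stackCount ℓ m 0 1 n
  t-total n = card-unique (coloredTree-finite A (suc n))
    (ΣFin-blocks ℓ m _ (rooted-low↔Fin n) (rooted-high↔Fin n) ↔-∘ colored↔rooted A (suc n))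

-- Closed forms

module _ (ℓ m : ℕ) where

  weighted-*-cong : ∀ c n f g → (∀ k j → k + j ≡ n → c * f k j ≡ g k j) →
    c * weighted ℓ m n f ≡ weighted ℓ m n g
  weighted-*-cong c n f g eq = trans
    (sym (antidiag-* c n (λ k j → f k j * (ℓ ^ j * m ^ k))))
    (antidiag-cong n λ k j k+j≡n → trans (sym (*-assoc c (f k j) _)) (cong (_* (ℓ ^ j * m ^ k)) (eq k j k+j≡n)))

  lowCount-closed : ∀ n →
    suc n * stackCount ℓ m 1 0 n ≡ weighted ℓ m n (λ k j → (suc n C k) * ((2 * n) C j))
  lowCount-closed n = weighted-*-cong (suc n) n (coeff 1 0) (λ k j → (suc n C k) * ((2 * n) C j)) λ { k j refl →
    trans (coeff-closed 1 0 k j n (2 * n) refl refl)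
          (cong ((suc n C k) *_) (trans (+-identityʳ _) (+-identityʳ _))) }

  -- `coeff-closed` for S alone divides by `k + j`, the number of vertices below the root, so there
  -- must be at least one. The lowered index in `C⁻` releases the factor ℓ.
  highCount-closed : ∀ n →
    suc n * stackCount ℓ m 0 1 (suc n) ≡ ℓ * weighted ℓ m n (λ k j → (suc n C k) * ((2 * suc n) C j))
  highCount-closed n = trans
    (weighted-*-cong (suc n) (suc n) (coeff 0 1) (λ k → shift (f k)) term)
    (weighted-shiftʳ ℓ m n f)
    where
    f : ℕ → ℕ → ℕ
    f k j = (suc n C k) * ((2 * suc n) C j)

    shift-* : ∀ c f j → c * shift f j ≡ shift (λ j → c * f j) j
    shift-* c f zero    = *-zeroʳ c
    shift-* c f (suc j) = refl

    term : ∀ k j → k + j ≡ suc n →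
      suc n * coeff 0 1 k j ≡ shift (f k) j
    term k j eq = begin
      suc n * coeff 0 1 k j                       ≡⟨ coeff-closed 0 1 k j n (2 * suc n) (sym eq)
                                                       (cong (λ x → suc (2 * x)) (sym eq)) ⟩
      (suc n C k) * ((2 * suc n) C⁻ j + 0)        ≡⟨ cong ((suc n C k) *_) (+-identityʳ _) ⟩
      (suc n C k) * ((2 * suc n) C⁻ j)            ≡⟨ shift-* (suc n C k) ((2 * suc n) C_) j ⟩
      shift (f k) j                               ∎

  -- With `N` = `suc n`, the two root counts carry the divisors `suc N` and `N`; multiplying by both
  -- makes them comparable. The terms then merge into (N + k) C(N+1, k) C(2N, j), and since j + (N +
  -- k) = 2N this equals 2N C(N+1, k) C(2N-1, j).
  totalCount-closed : ∀ n →
    suc (suc n) * (ℓ * stackCount ℓ m 1 0 (suc n) + m * stackCount ℓ m 0 1 (suc n)) ≡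
    2 * (ℓ * weighted ℓ m (suc n) (λ k j → (suc (suc n) C k) * (suc (2 * n) C j)))
  totalCount-closed n = *-cancelˡ-≡ _ _ N (begin
    N * (suc N * (ℓ * u + m * v))
      ≡⟨ l₁ N ℓ m u v ⟩
    ℓ * (N * (suc N * u)) + suc N * (m * (N * v))
      ≡⟨ cong₂ (λ x y → ℓ * (N * x) + suc N * (m * y)) (lowCount-closed N) (highCount-closed n) ⟩
    ℓ * (N * w L) + suc N * (m * (ℓ * weighted ℓ m n H))
      ≡⟨ l₂ N ℓ m (w L) (weighted ℓ m n H) ⟩
    ℓ * (N * w L + suc N * (m * weighted ℓ m n H))
      ≡⟨ cong (λ x → ℓ * (N * w L + suc N * x)) (weighted-shiftˡ ℓ m n H) ⟨
    ℓ * (N * w L + suc N * w H⁺)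
      ≡⟨ cong (ℓ *_) (cong₂ _+_
           (weighted-*-cong N N L (λ k j → N * L k j) λ _ _ _ → refl)
           (weighted-*-cong (suc N) N H⁺ (λ k j → suc N * H⁺ k j) λ _ _ _ → refl)) ⟩
    ℓ * (w (λ k j → N * L k j) + w (λ k j → suc N * H⁺ k j))
      ≡⟨ cong (ℓ *_) (weighted-+ ℓ m N (λ k j → N * L k j) (λ k j → suc N * H⁺ k j)) ⟨
    ℓ * w (λ k j → N * L k j + suc N * H⁺ k j)
      ≡⟨ cong (ℓ *_) (weighted-*-cong (2 * N) N G (λ k j → N * L k j + suc N * H⁺ k j) λ k j eq → sym (term k j eq)) ⟨
    ℓ * (2 * N * w G)
      ≡⟨ l₃ ℓ N (w G) ⟩
    N * (2 * (ℓ * w G)) ∎)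
    where
    N = suc n
    u = stackCount ℓ m 1 0 N
    v = stackCount ℓ m 0 1 N
    w = weighted ℓ m N

    L H H⁺ G : ℕ → ℕ → ℕ
    L k j  = (suc N C k) * ((2 * N) C j)
    H k j  = (N C k) * ((2 * N) C j)
    H⁺ k j = shift (λ k → H k j) k
    G k j  = (suc N C k) * (suc (2 * n) C j)

    l₁ : ∀ N ℓ m u v → N * (suc N * (ℓ * u + m * v)) ≡ ℓ * (N * (suc N * u)) + suc N * (m * (N * v))
    l₁ = solve-∀
    l₂ : ∀ N ℓ m x y → ℓ * (N * x) + suc N * (m * (ℓ * y)) ≡ ℓ * (N * x + suc N * (m * y))
    l₂ = solve-∀
    l₃ : ∀ ℓ N x → ℓ * (2 * N * x) ≡ N * (2 * (ℓ * x))
    l₃ = solve-∀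
    l₄ : ∀ N d x a → N * (d * x) + suc N * (a * x) ≡ (N * d + suc N * a) * x
    l₄ = solve-∀
    l₅ : ∀ N d k x → (N * d + k * d) * x ≡ d * ((N + k) * x)
    l₅ = solve-∀
    l₆ : ∀ d a b → d * (a * b) ≡ a * (d * b)
    l₆ = solve-∀
    l₇ : ∀ k j N → j + (N + k) ≡ N + (k + j)
    l₇ = solve-∀
    l₈ : ∀ n → suc n + suc n ≡ suc (suc (2 * n))
    l₈ = solve-∀
    l₉ : ∀ n → 2 * suc n ≡ suc (suc (2 * n))
    l₉ = solve-∀

    H⁺-C⁻ : ∀ k j → H⁺ k j ≡ (N C⁻ k) * ((2 * N) C j)
    H⁺-C⁻ zero    j = refl
    H⁺-C⁻ (suc k) j = refl

    complement : ∀ k j → k + j ≡ N → (N + k) * ((2 * N) C j) ≡ (2 * N) * (suc (2 * n) C j)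
    complement k j eq = begin
      (N + k) * ((2 * N) C j)
        ≡⟨ cong (λ x → (N + k) * (x C j)) (l₉ n) ⟩
      (N + k) * (suc (suc (2 * n)) C j)
        ≡⟨ absorption-complement (suc (2 * n)) j (N + k)
             (trans (l₇ k j N) (trans (cong (λ x → N + x) eq) (l₈ n))) ⟨
      suc (suc (2 * n)) * (suc (2 * n) C j)
        ≡⟨ cong (_* (suc (2 * n) C j)) (l₉ n) ⟨
      (2 * N) * (suc (2 * n) C j) ∎

    term : ∀ k j → k + j ≡ N → N * L k j + suc N * H⁺ k j ≡ (2 * N) * G k j
    term k j eq = begin
      N * L k j + suc N * H⁺ k j
        ≡⟨ cong (λ x → N * L k j + suc N * x) (H⁺-C⁻ k j) ⟩
      N * L k j + suc N * ((N C⁻ k) * x)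
        ≡⟨ l₄ N d x (N C⁻ k) ⟩
      (N * d + suc N * (N C⁻ k)) * x
        ≡⟨ cong (λ y → (N * d + y) * x) (absorption N k) ⟨
      (N * d + k * d) * x
        ≡⟨ l₅ N d k x ⟩
      d * ((N + k) * x)
        ≡⟨ cong (d *_) (complement k j eq) ⟩
      d * ((2 * N) * (suc (2 * n) C j))
        ≡⟨ l₆ d (2 * N) _ ⟩
      (2 * N) * G k j ∎
      where
      d = suc N C k
      x = (2 * N) C j

-- From identities of naturals to rational sums

fromℕ-+ : ∀ a b → fromℕ (a + b) ≡ fromℕ a +ℚ fromℕ b
fromℕ-+ a b = ℚ.toℚᵘ-injective (begin-equality
  toℚᵘ (fromℕ (a + b))                    ≃⟨ ℚ.toℚᵘ-fromℚᵘ (mkℚᵘ (+ (a + b)) 0) ⟩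
  mkℚᵘ (+ (a + b)) 0                      ≃⟨ *≡* (cong (_*ℤ + 1)
                                               (sym (cong₂ _+ℤ_ (ℤ.*-identityʳ (+ a)) (ℤ.*-identityʳ (+ b))))) ⟩
  mkℚᵘ (+ a) 0 ℚᵘ.+ mkℚᵘ (+ b) 0          ≃⟨ ℚᵘ.+-cong (ℚ.toℚᵘ-fromℚᵘ (mkℚᵘ (+ a) 0)) (ℚ.toℚᵘ-fromℚᵘ (mkℚᵘ (+ b) 0)) ⟨
  toℚᵘ (fromℕ a) ℚᵘ.+ toℚᵘ (fromℕ b)      ≃⟨ ℚ.toℚᵘ-homo-+ (fromℕ a) (fromℕ b) ⟨
  toℚᵘ (fromℕ a +ℚ fromℕ b)               ∎ᵘ)
  where open ℚᵘ.≤-Reasoning renaming (_∎ to _∎ᵘ)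

-- Between unnormalised fractions the claim is the hypothesis, cross-multiplied.
fromℕ-fraction : ∀ c d a b → suc d * a ≡ c * b → fromℕ a ≡ (+ c / suc d) *ℚ fromℕ b
fromℕ-fraction c d a b eq = ℚ.toℚᵘ-injective (begin-equality
  toℚᵘ (fromℕ a)                                ≃⟨ ℚ.toℚᵘ-fromℚᵘ (mkℚᵘ (+ a) 0) ⟩
  mkℚᵘ (+ a) 0                                  ≃⟨ *≡* cross ⟩
  mkℚᵘ (+ c) d ℚᵘ.* mkℚᵘ (+ b) 0                ≃⟨ ℚᵘ.*-cong (ℚ.toℚᵘ-fromℚᵘ (mkℚᵘ (+ c) d))
                                                             (ℚ.toℚᵘ-fromℚᵘ (mkℚᵘ (+ b) 0)) ⟨
  toℚᵘ (+ c / suc d) ℚᵘ.* toℚᵘ (fromℕ b)        ≃⟨ ℚ.toℚᵘ-homo-* (+ c / suc d) (fromℕ b) ⟨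
  toℚᵘ ((+ c / suc d) *ℚ fromℕ b)               ∎ᵘ)
  where
  open ℚᵘ.≤-Reasoning renaming (_∎ to _∎ᵘ)

  lemma : ∀ a d → a * (suc d * 1) ≡ suc d * a
  lemma = solve-∀

  cross : + a *ℤ + (suc d * 1) ≡ (+ c *ℤ + b) *ℤ + 1
  cross = trans (sym (ℤ.pos-* a (suc d * 1)))
    (trans (cong +_ (trans (lemma a d) eq)) (trans (ℤ.pos-* c b) (sym (ℤ.*-identityʳ _))))

-- Here `h` is a summand as the formulas write it, with truncated subtractions in `k`; `g` has the
-- complementary index `j` instead.
sum-antidiag : ∀ q n (h : ℕ → ℕ) (g : ℕ → ℕ → ℕ) → (∀ k j → k + j ≡ n → h k ≡ g k j) →
  foldr _+ℚ_ 0ℚ (applyUpTo (λ k → q *ℚ fromℕ (h k)) (suc n)) ≡ q *ℚ fromℕ (antidiag n g)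
sum-antidiag q zero    h g h≡g = trans (ℚ.+-identityʳ _) (cong (λ x → q *ℚ fromℕ x) (h≡g 0 0 refl))
sum-antidiag q (suc n) h g h≡g = begin
  q *ℚ fromℕ (h 0) +ℚ foldr _+ℚ_ 0ℚ (applyUpTo (λ k → q *ℚ fromℕ (h (suc k))) (suc n))
    ≡⟨ cong₂ _+ℚ_ (cong (λ x → q *ℚ fromℕ x) (h≡g 0 (suc n) refl))
         (sum-antidiag q n (λ k → h (suc k)) (λ k → g (suc k)) λ k j eq → h≡g (suc k) j (cong suc eq)) ⟩
  q *ℚ fromℕ (g 0 (suc n)) +ℚ q *ℚ fromℕ (antidiag n (λ k → g (suc k)))
    ≡⟨ ℚ.*-distribˡ-+ q _ _ ⟨
  q *ℚ (fromℕ (g 0 (suc n)) +ℚ fromℕ (antidiag n (λ k → g (suc k))))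
    ≡⟨ cong (q *ℚ_) (fromℕ-+ (g 0 (suc n)) _) ⟨
  q *ℚ fromℕ (antidiag (suc n) g) ∎

fromℕ-sum : ∀ c d a n (h : ℕ → ℕ) (g : ℕ → ℕ → ℕ) → (∀ k j → k + j ≡ n → h k ≡ g k j) →
  suc d * a ≡ c * antidiag n g →
  fromℕ a ≡ foldr _+ℚ_ 0ℚ (map (λ k → (+ c / suc d) *ℚ fromℕ (h k)) (upTo (suc n)))
fromℕ-sum c d a n h g h≡g eq = begin
  fromℕ a                                   ≡⟨ fromℕ-fraction c d a (antidiag n g) eq ⟩
  q *ℚ fromℕ (antidiag n g)                 ≡⟨ sum-antidiag q n h g h≡g ⟨
  foldr _+ℚ_ 0ℚ (applyUpTo f (suc n))       ≡⟨ cong (foldr _+ℚ_ 0ℚ) (map-upTo f (suc n)) ⟨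
  foldr _+ℚ_ 0ℚ (map f (upTo (suc n)))      ∎
  where
  q = + c / suc d
  f = λ k → q *ℚ fromℕ (h k)

suc∸ : ∀ {n} k j → k + j ≡ n → suc n ∸ k ≡ suc j
suc∸ k j refl = trans (cong (_∸ k) (sym (+-suc k j))) (m+n∸m≡n k (suc j))

theorem33 : (ℓ m n : ℕ) .{{_ : NonZero ℓ}} .{{_ : NonZero m}} .{{_ : NonZero n}} →
    (2 ≤ n →
    fromℕ (t (blockMatrix ℓ m) n) ≡
    ∑[ k ∈ 0 ⋯ n ∸ 1 ]
    (+ 2 / n) *ℚ fromℕ ((n C k) * ((2 * n ∸ 3) C (n ∸ k ∸ 1)) * ℓ ^ (n ∸ k) * m ^ k))
    × ((i : Fin (ℓ + m)) → toℕ i < ℓ →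
    fromℕ (tRoot (blockMatrix ℓ m) i n) ≡
    ∑[ k ∈ 0 ⋯ n ∸ 1 ]
    (+ 1 / n) *ℚ fromℕ ((n C k) * ((2 * n ∸ 2) C (n ∸ k ∸ 1)) * ℓ ^ (n ∸ k ∸ 1) * m ^ k))
    × ((i : Fin (ℓ + m)) → ℓ ≤ toℕ i → (2≤n : 2 ≤ n) →
    fromℕ (tRoot (blockMatrix ℓ m) i n) ≡
    ∑[ k ∈ 1 ⋯ n ∸ 1 ]
    (_/_ (+ 1) (n ∸ 1) {{n∸1-nonZero 2≤n}})
    *ℚ fromℕ (((n ∸ 1) C (k ∸ 1)) * ((2 * n ∸ 2) C (n ∸ k ∸ 1)) * ℓ ^ (n ∸ k) * m ^ (k ∸ 1)))
theorem33 ℓ m n = total-formula n , low-formula n , high-formula n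
  where
  factor : ∀ ℓ a b x y → a * b * (ℓ * x) * y ≡ ℓ * (a * b * (x * y))
  factor = solve-∀

  2[1+n]∸2 : ∀ n → 2 * suc n ∸ 2 ≡ 2 * n
  2[1+n]∸2 n = cong (_∸ 2) (*-suc 2 n)

  2[2+n]∸3 : ∀ n → 2 * suc (suc n) ∸ 3 ≡ suc (2 * n)
  2[2+n]∸3 n = cong (_∸ 3) (trans (*-suc 2 (suc n)) (cong (λ x → 2 + x) (*-suc 2 n)))

  total-formula : ∀ n .{{_ : NonZero n}} → 2 ≤ n → fromℕ (t (blockMatrix ℓ m) n) ≡
    ∑[ k ∈ 0 ⋯ n ∸ 1 ]
      (+ 2 / n) *ℚ fromℕ ((n C k) * ((2 * n ∸ 3) C (n ∸ k ∸ 1)) * ℓ ^ (n ∸ k) * m ^ k)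
  -- For one vertex the count is ℓ + m, while the expression with truncated subtraction gives 2ℓ;
  -- the argument starts at two vertices.
  total-formula (suc (suc n)) (s≤s (s≤s z≤n)) = trans
    (cong fromℕ (t-total ℓ m (suc n)))
    (fromℕ-sum 2 (suc n) (ℓ * stackCount ℓ m 1 0 (suc n) + m * stackCount ℓ m 0 1 (suc n)) (suc n) _
      (λ k j → ℓ * g k j) term
      (trans (totalCount-closed ℓ m n) (cong (2 *_) (sym (antidiag-* ℓ (suc n) g)))))
    where
    g : ℕ → ℕ → ℕ
    g k j = (suc (suc n) C k) * (suc (2 * n) C j) * (ℓ ^ j * m ^ k)

    term : ∀ k j → k + j ≡ suc n →
      (suc (suc n) C k) * ((2 * suc (suc n) ∸ 3) C (suc (suc n) ∸ k ∸ 1)) * ℓ ^ (suc (suc n) ∸ k) * m ^ k ≡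
      ℓ * g k j
    term k j eq = trans
      (cong₂ (λ M r → (suc (suc n) C k) * (M C (r ∸ 1)) * ℓ ^ r * m ^ k) (2[2+n]∸3 n) (suc∸ k j eq))
      (factor ℓ (suc (suc n) C k) (suc (2 * n) C j) (ℓ ^ j) (m ^ k))

  low-formula : ∀ n .{{_ : NonZero n}} → (i : Fin (ℓ + m)) → toℕ i < ℓ →
    fromℕ (tRoot (blockMatrix ℓ m) i n) ≡
    ∑[ k ∈ 0 ⋯ n ∸ 1 ]
      (+ 1 / n) *ℚ fromℕ ((n C k) * ((2 * n ∸ 2) C (n ∸ k ∸ 1)) * ℓ ^ (n ∸ k ∸ 1) * m ^ k)
  low-formula (suc n) i i<ℓ = trans
    (cong fromℕ (tRoot-low ℓ m n i i<ℓ))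
    (fromℕ-sum 1 n (stackCount ℓ m 1 0 n) n _ g term
      (trans (lowCount-closed ℓ m n) (sym (*-identityˡ _))))
    where
    g : ℕ → ℕ → ℕ
    g k j = (suc n C k) * ((2 * n) C j) * (ℓ ^ j * m ^ k)

    term : ∀ k j → k + j ≡ n →
      (suc n C k) * ((2 * suc n ∸ 2) C (suc n ∸ k ∸ 1)) * ℓ ^ (suc n ∸ k ∸ 1) * m ^ k ≡ g k j
    term k j eq = trans
      (cong₂ (λ M r → (suc n C k) * (M C (r ∸ 1)) * ℓ ^ (r ∸ 1) * m ^ k) (2[1+n]∸2 n) (suc∸ k j eq))
      (*-assoc ((suc n C k) * ((2 * n) C j)) (ℓ ^ j) (m ^ k))

  high-formula : ∀ n → (i : Fin (ℓ + m)) → ℓ ≤ toℕ i → (2≤n : 2 ≤ n) →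
    fromℕ (tRoot (blockMatrix ℓ m) i n) ≡
    ∑[ k ∈ 1 ⋯ n ∸ 1 ]
      (_/_ (+ 1) (n ∸ 1) {{n∸1-nonZero 2≤n}})
        *ℚ fromℕ (((n ∸ 1) C (k ∸ 1)) * ((2 * n ∸ 2) C (n ∸ k ∸ 1)) * ℓ ^ (n ∸ k) * m ^ (k ∸ 1))
  -- The sum starts at 1, so the `k` of `antidiag` is the index of the formula minus one. The
  -- exponent of ℓ is `suc j`, whence the extra factor in `ℓ * g k j`.
  high-formula (suc (suc n)) i ℓ≤i (s≤s (s≤s z≤n)) = trans
    (cong fromℕ (tRoot-high ℓ m (suc n) i ℓ≤i))
    (fromℕ-sum 1 n (stackCount ℓ m 0 1 (suc n)) n _ (λ k j → ℓ * g k j) term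
      (trans (highCount-closed ℓ m n) (trans (sym (antidiag-* ℓ n g)) (sym (*-identityˡ _)))))
    where
    g : ℕ → ℕ → ℕ
    g k j = (suc n C k) * ((2 * suc n) C j) * (ℓ ^ j * m ^ k)

    term : ∀ k j → k + j ≡ n →
      (suc n C k) * ((2 * suc (suc n) ∸ 2) C (suc n ∸ k ∸ 1)) * ℓ ^ (suc n ∸ k) * m ^ k ≡
      ℓ * g k j
    term k j eq = trans
      (cong₂ (λ M r → (suc n C k) * (M C (r ∸ 1)) * ℓ ^ r * m ^ k) (2[1+n]∸2 (suc n)) (suc∸ k j eq))
      (factor ℓ (suc n C k) ((2 * suc n) C j) (ℓ ^ j) (m ^ k))
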